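{- Let $k\in\mathbb{N}$ and let $\ell(\cdot)$ be a lazy deterministic tree traversal algorithm that is $c_k$-competitive on all layered tree instances of width at most $k$. Then there is a distributed asynchronous collective tree exploration (DACTE) algorithm (using $\ell(\cdot)$ as a subroutine) with $k$ robots that explores any tree with $n$ nodes and depth $D$ in at most $2n+k c_k D$ moves.
   Context: Nodes and layers. Let $\mathcal{V}=\bigcup_{d\ge 0}\mathbb{N}^d$ be the set of finite sequences of natural numbers (the empty sequence is the root $r$); $v$ is an ancestor of $u$ (written $v\succeq u$) if $v$ is a prefix of $u$; $d(u,v)$ is the usual tree distance $d(u)+d(v)-2d(A(u,v))$ where $d(\cdot)$ is length and $A(u,v)$ the longest common prefix. A layer is a finite set of pairwise incomparable nodes (an antichain for $\succeq$). For layers $\mathcal{L},\mathcal{L}'$, write $\mathcal{L}\succeq\mathcal{L}'$ if every node of $\mathcal{L}'$ has an ancestor in $\mathcal{L}$. The active tree of a layer is $\mathcal{T}(\mathcal{L})=\{u\in\mathcal{V}: u \text{ has a descendant in }\mathcal{L}\}$. A layered tree instance is a sequence $\mathcal{L}(1)\succeq\mathcal{L}(2)\succeq\cdots$ of layers; its underlying tree is $\bigcup_t\mathcal{T}(\mathcal{L}(t))$, its depth $D$ is the depth of the underlying tree, and its width is $\max_t|\mathcal{L}(t)|$. A deterministic tree traversal algorithm maps each partial input $(\mathcal{L}(1),\dots,\mathcal{L}(t))$ to a node $\ell(t)\in\mathcal{L}(t)$; its cost on the instance is $\sum_t d(\ell(t-1),\ell(t))$. It is $c_w$-competitive on width-$w$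 instances if its cost is at most $c_w D$ on every instance of width at most $w$ and depth $D$. It is lazy if $\ell(t)\in\mathcal{L}(t+1)$ implies $\ell(t+1)=\ell(t)$. DACTE model. An unknown finite rooted tree is explored by $k$ robots starting at the root. Every node carries an unbounded whiteboard; robots have unbounded memory and computation; all initially empty. At each round an omniscient adversary selects one robot, which (1) reads the whiteboard at its node, (2) observes the adjacent nodes, (3) writes on that whiteboard and updates its memory, (4) moves along an edge to a neighbour (no reading/writing at the destination). Each round is one move. A node is visited once a robot located there has been activated; exploration finishes when all nodes are visited. The algorithm explores in at most $M$ moves if, against every adversary, it finishes within $M$ rounds.
   Formalization: The competitive ratio c_k is taken to be a rational number instead of a real one. -}

module Defs where

open import Data.Nat using (ℕ; zero; suc; _+_; _*_; _∸_; _≤_; _<_; _≡ᵇ_)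
open import Data.Integer using (+_)
open import Data.Rational using (ℚ; _/_)
open import Data.Bool using (Bool; true; false; _∧_; _∨_; if_then_else_)
open import Data.List using (List; []; _∷_; _++_; [_]; length; map; filterᵇ; inits; drop; _∷ʳ_)
open import Data.List.Properties using (≡-dec)
open import Data.List.Membership.Propositional using (_∈_)
open import Data.List.Relation.Unary.All using (All)
open import Data.List.Relation.Unary.Unique.Propositional using (Unique)
open import Data.List.Relation.Unary.Linked using (Linked)
open import Data.Fin using (Fin)
open import Data.Product using (Σ; ∃; _×_; _,_; proj₁; proj₂)
open import Relation.Nullary using (¬_; does)
open import Relation.Binary.PropositionalEquality using (_≡_)
import Data.Nat as ℕ
import Data.Fin as Fin

-- Nodes of the infinite tree 𝒱 = ⋃_d ℕ^d (finite sequences; root = [])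

Node : Set
Node = List ℕ

root : Node
root = []

depth : Node → ℕ
depth = length

-- v ≼ u : v is a prefix of u, i.e. v is an ancestor of u (v ⪰ u in the paper;
-- reflexive: every node is its own ancestor)
_≼_ : Node → Node → Set
v ≼ u = ∃ λ w → v ++ w ≡ u

lcp : Node → Node → Node
lcp [] _ = []
lcp (_ ∷ _) [] = []
lcp (a ∷ u) (b ∷ v) = if a ≡ᵇ b then a ∷ lcp u v else []

dist : Node → Node → ℕ
dist u v = (depth u + depth v) ∸ (2 * depth (lcp u v))

-- A layer: a finite set of pairwise incomparable nodes, represented by a
-- duplicate-free list.
Layer : Set
Layer = List Node

IsLayer : Layer → Set
IsLayer L = Unique L × (∀ {u v} → u ∈ L → v ∈ L → u ≼ v → u ≡ v)

_⪰ₗ_ : Layer → Layer → Set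
L ⪰ₗ L' = ∀ {v} → v ∈ L' → ∃ λ u → u ∈ L × u ≼ v

-- A (finite) layered tree instance L(1) ⪰ L(2) ⪰ ... ⪰ L(T), given as the
-- list [L(1), ..., L(T)].  Layers are nonempty (so that ℓ(t) ∈ L(t) is possible).
NonEmpty : Layer → Set
NonEmpty L = ∃ λ u → u ∈ L

IsInstance : List Layer → Set
IsInstance ls = All (λ L → IsLayer L × NonEmpty L) ls × Linked _⪰ₗ_ ls

InUnderlying : List Layer → Node → Set
InUnderlying ls u = ∃ λ L → L ∈ ls × ∃ λ v → v ∈ L × u ≼ v

InstanceDepth : List Layer → ℕ → Set
InstanceDepth ls D =
  (∀ u → InUnderlying ls u → depth u ≤ D) × (∃ λ u → InUnderlying ls u × depth u ≡ D)

WidthAtMost : ℕ → List Layer → Set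
WidthAtMost w ls = All (λ L → length L ≤ w) ls

-- ℓ maps a partial input [L(1), ..., L(t)] to the node ℓ(t).
TraversalFn : Set
TraversalFn = List Layer → Node

IsTraversal : TraversalFn → Set
IsTraversal ℓ = ∀ ls L → IsInstance (ls ∷ʳ L) → ℓ (ls ∷ʳ L) ∈ L

IsLazy : TraversalFn → Set
IsLazy ℓ = ∀ ls L L' → IsInstance ((ls ∷ʳ L) ∷ʳ L') →
  ℓ (ls ∷ʳ L) ∈ L' → ℓ ((ls ∷ʳ L) ∷ʳ L') ≡ ℓ (ls ∷ʳ L)

walkLength : List Node → ℕ
walkLength [] = 0
walkLength (_ ∷ []) = 0
walkLength (u ∷ v ∷ us) = dist u v + walkLength (v ∷ us)

cost : TraversalFn → List Layer → ℕ
cost ℓ ls = walkLength (root ∷ map ℓ (drop 1 (inits ls)))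

ℕ→ℚ : ℕ → ℚ
ℕ→ℚ m = (+ m) / 1

Competitive : TraversalFn → ℚ → ℕ → Set
Competitive ℓ c w = ∀ ls D → IsInstance ls → WidthAtMost w ls → InstanceDepth ls D →
  ℕ→ℚ (cost ℓ ls) Data.Rational.≤ c Data.Rational.* ℕ→ℚ D

-- Finite rooted trees (explored in the DACTE model), as finite
-- prefix-closed subsets of 𝒱 given by duplicate-free lists.

IsFiniteTree : List Node → Set
IsFiniteTree T = Unique T × root ∈ T × (∀ u i → (u ∷ʳ i) ∈ T → u ∈ T)

TreeDepth : List Node → ℕ → Set
TreeDepth T D = (∀ u → u ∈ T → depth u ≤ D) × (∃ λ u → u ∈ T × depth u ≡ D)

isChildᵇ : Node → Node → Bool
isChildᵇ [] (_ ∷ []) = true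
isChildᵇ [] _ = false
isChildᵇ (_ ∷ _) [] = false
isChildᵇ (a ∷ u) (b ∷ v) = (a ≡ᵇ b) ∧ isChildᵇ u v

neighbours : List Node → Node → List Node
neighbours T u = filterᵇ (λ v → isChildᵇ u v ∨ isChildᵇ v u) T

-- DACTE algorithms: all robots run the same deterministic program with
-- unbounded memory (type Mem) and unbounded whiteboards (type Board).

record DACTE : Set₁ where
  field
    Mem    : Set
    Board  : Set
    mem₀   : Mem
    board₀ : Board
    -- activation: given memory, whiteboard at the current node and the
    -- adjacent nodes, return new memory, new whiteboard, and the target node.
    step   : Mem → Board → List Node → Mem × Board × Node

open DACTE public

record Config (A : DACTE) (k : ℕ) : Set where
  field
    pos   : Fin k → Node
    mem   : Fin k → Mem A
    board : Node → Board A

open Config public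

initConfig : (A : DACTE) (k : ℕ) → Config A k
initConfig A k = record { pos = λ _ → root ; mem = λ _ → mem₀ A ; board = λ _ → board₀ A }

updFin : ∀ {k} {X : Set} → (Fin k → X) → Fin k → X → Fin k → X
updFin f i x j = if does (j Fin.≟ i) then x else f j

updNode : {X : Set} → (Node → X) → Node → X → Node → X
updNode f u x v = if does (≡-dec ℕ._≟_ v u) then x else f v

activation : (A : DACTE) {k : ℕ} → List Node → Config A k → Fin k → Mem A × Board A × Node
activation A T c i = step A (mem c i) (board c (pos c i)) (neighbours T (pos c i))

round : (A : DACTE) {k : ℕ} → List Node → Fin k → Config A k → Config A k
round A T i c =
  let p = pos c i
      o = activation A T c i
  in record { pos   = updFin (pos c) i (proj₂ (proj₂ o))
            ; mem   = updFin (mem c) i (proj₁ o)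
            ; board = updNode (board c) p (proj₁ (proj₂ o)) }

-- the adversary's schedule: σ s is the robot activated at round s (0-indexed).
-- (As the algorithm is deterministic, adaptive adversaries reduce to schedules.)
run : (A : DACTE) (k : ℕ) → List Node → (ℕ → Fin k) → ℕ → Config A k
run A k T σ zero = initConfig A k
run A k T σ (suc s) = round A T (σ s) (run A k T σ s)

AllVisited : (A : DACTE) (k : ℕ) → List Node → (ℕ → Fin k) → ℕ → Set
AllVisited A k T σ t = ∀ u → u ∈ T → ∃ λ s → s < t × pos (run A k T σ s) (σ s) ≡ u

ValidMove : (A : DACTE) (k : ℕ) → List Node → (ℕ → Fin k) → ℕ → Set
ValidMove A k T σ s =
  let c = run A k T σ s in
  proj₂ (proj₂ (activation A T c (σ s))) ∈ neighbours T (pos c (σ s))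

ExploresWithin : (A : DACTE) (k : ℕ) → List Node → (ℕ → Fin k) → ℚ → Set
ExploresWithin A k T σ m =
  (∀ s → ¬ AllVisited A k T σ (suc s) → ValidMove A k T σ s) ×
  (∃ λ t → ℕ→ℚ t Data.Rational.≤ m × AllVisited A k T σ t)

{-# OPTIONS --safe #-}

-- A robot crosses an untaken child edge whenever it sees one.  Otherwise its node p is *mined*; the
-- robot merges its knowledge with the whiteboard, feeds ℓ the layer of topmost nodes not known to be
-- mined, and moves one step towards the node chosen by ℓ.  So every move either crosses a new edge or
-- approaches the target, whence (moves) + dist (position, target) ≤ 2 (new edges) + (cost of ℓ) for
-- each robot, and summation over the robots gives the bound.
--
-- Layers have width at most k because a robot that first reached v leaves the subtree of v only after
-- v is mined, and then carries that news along: if it later first reaches v′ outside that subtree, then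
-- whoever learns that the edge above v′ is taken also learns that v is mined.  Hence the nodes of a
-- layer were first reached by distinct robots.
module Submission where

open import Defs
open import Data.Bool using (T; true)
open import Data.Bool.Properties using (T-∨)
open import Data.Fin as Fin using (Fin; zero; suc)
open import Data.Fin.Properties using (injective⇒≤; nonZeroIndex)
import Data.Integer as ℤ
import Data.Integer.Properties as ℤ
open import Data.List using (List; []; _∷_; _++_; [_]; length; map; filter; filterᵇ; inits; drop; concat; _∷ʳ_; deduplicate; lookup; initLast; _∷ʳ′_)
open import Data.List.Membership.Propositional using (_∈_; _∉_)
open import Data.List.Membership.Propositional.Properties
open import Data.List.Properties using (≡-dec; ++-assoc; ++-identityʳ; length-++; length-map; map-++; ∷-injective; ∷ʳ-injectiveˡ)
open import Data.List.Relation.Unary.All as All using (All; []; _∷_)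
open import Data.List.Relation.Unary.All.Properties using (∷ʳ⁺; ¬Any⇒All¬)
open import Data.List.Relation.Unary.AllPairs using ([]; _∷_)
open import Data.List.Relation.Unary.Any using (here; there; index)
open import Data.List.Relation.Unary.Any.Properties using (lookup-index)
open import Data.List.Relation.Unary.Linked using (Linked; [-]; _∷_)
open import Data.List.Relation.Unary.Unique.Propositional using (Unique)
open import Data.List.Relation.Unary.Unique.Propositional.Properties using () renaming (filter⁺ to Unique-filter⁺)
open import Data.Nat as ℕ using (ℕ; zero; suc; _+_; _*_; _≤_; _<_; _≡ᵇ_; z≤n; s≤s)
open import Data.Nat.Properties
open import Data.Nat.Solver using (module +-*-Solver)
open import Data.Product using (Σ; ∃; _×_; _,_; proj₁; proj₂)
open import Data.Rational as ℚ using (ℚ)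
import Data.Rational.Properties as ℚ
import Data.Rational.Unnormalised as ℚᵘ
import Data.Rational.Unnormalised.Properties as ℚᵘ
open import Data.Sum using (_⊎_; inj₁; inj₂; [_,_]′)
open import Function using (Equivalence; _∘_)
open import Relation.Binary.PropositionalEquality using (_≡_; _≢_; refl; sym; trans; cong; cong₂; subst)
open import Relation.Nullary using (¬_; Dec; yes; no; contradiction)
open import Relation.Nullary.Decidable using (dec-true; dec-false; ¬?; _×-dec_; _⊎-dec_)
open import Relation.Unary using (Decidable)
open import Algebra.Properties.CommutativeMonoid.Sum +-0-commutativeMonoid using (sum; sum-cong-≗; sum-replicate-zero; ∑-distrib-+)

-- Ancestors and children.

≼-refl : ∀ {u} → u ≼ u
≼-refl {u} = [] , ++-identityʳ u

≼-trans : ∀ {u v w} → u ≼ v → v ≼ w → u ≼ w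
≼-trans {u} (x , refl) (y , refl) = x ++ y , sym (++-assoc u x y)

≼-∷ʳ : ∀ {u} a → u ≼ (u ∷ʳ a)
≼-∷ʳ a = [ a ] , refl

≼-cons : ∀ {u v} a → u ≼ v → (a ∷ u) ≼ (a ∷ v)
≼-cons a (w , refl) = w , refl

≼-depth : ∀ {u v} → u ≼ v → depth u ≤ depth v
≼-depth {u} (w , refl) = ≤-trans (m≤m+n (length u) (length w)) (≤-reflexive (sym (length-++ u)))

≼-∷ʳ⁻ : ∀ {u v a} → u ≼ (v ∷ʳ a) → u ≡ v ∷ʳ a ⊎ u ≼ v
≼-∷ʳ⁻ {[]} {v} _ = inj₂ (v , refl)
≼-∷ʳ⁻ {b ∷ []} {[]} ([] , refl) = inj₁ refl
≼-∷ʳ⁻ {b ∷ u} {c ∷ v} (w , eq) with ∷-injective eq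
... | refl , eq′ with ≼-∷ʳ⁻ {u} {v} (w , eq′)
...   | inj₁ refl = inj₁ refl
...   | inj₂ p = inj₂ (≼-cons b p)

≼⇒∈inits : ∀ {u v} → u ≼ v → u ∈ inits v
≼⇒∈inits {[]} _ = here refl
≼⇒∈inits {a ∷ u} (w , refl) = there (∈-map⁺ (a ∷_) (≼⇒∈inits {u} (w , refl)))

∈inits⇒≼ : ∀ {u} v → u ∈ inits v → u ≼ v
∈inits⇒≼ v (here refl) = v , refl
∈inits⇒≼ (a ∷ v) (there i) with ∈-map⁻ (a ∷_) i
... | u , j , refl = ≼-cons a (∈inits⇒≼ v j)

isChild⁺ : ∀ u a → T (isChildᵇ u (u ∷ʳ a))
isChild⁺ [] a = _
-- `does (b ℕ.≟ b)` is `b ≡ᵇ b`, so this settles the boolean test inside `isChildᵇ`; the tests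
-- inside `lcp` are treated alike.
isChild⁺ (b ∷ u) a rewrite dec-true (b ℕ.≟ b) refl = isChild⁺ u a

isChild⁻ : ∀ u v → T (isChildᵇ u v) → ∃ λ a → v ≡ u ∷ʳ a
isChild⁻ [] (a ∷ []) _ = a , refl
isChild⁻ (a ∷ u) (b ∷ v) h with a ≡ᵇ b in eq
... | true with ≡ᵇ⇒≡ a b (subst T (sym eq) _) | isChild⁻ u v h
...   | refl | c , refl = c , refl

-- The tree distance.

dist-[]ʳ : ∀ u → dist u [] ≡ length u
dist-[]ʳ [] = refl
dist-[]ʳ (a ∷ u) = +-identityʳ _

dist-∷-≡ : ∀ a u v → dist (a ∷ u) (a ∷ v) ≡ dist u v
dist-∷-≡ a u v rewrite dec-true (a ℕ.≟ a) refl
  | +-suc (length u) (length v)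
  | +-suc (length (lcp u v)) (length (lcp u v) + 0) = refl

dist-∷-≢ : ∀ {a b} u v → a ≢ b → dist (a ∷ u) (b ∷ v) ≡ suc (length u) + suc (length v)
dist-∷-≢ {a} {b} u v a≢b rewrite dec-false (a ℕ.≟ b) a≢b = refl

dist≤length+length : ∀ u v → dist u v ≤ length u + length v
dist≤length+length u v = m∸n≤m (length u + length v) (2 * length (lcp u v))

-- The triangle inequality with the root as one endpoint. This lemma and the next one serve the
-- cases of `dist-triangle` where a node is the root or only one pair of heads agrees.
length≤dist+length : ∀ u v → length u ≤ dist u v + length v
length≤dist+length [] v = z≤n
length≤dist+length (a ∷ u) [] = ≤-trans (≤-reflexive (sym (dist-[]ʳ (a ∷ u)))) (m≤m+n _ 0)
length≤dist+length (a ∷ u) (b ∷ v) with a ℕ.≟ b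
... | yes refl rewrite dist-∷-≡ a u v | +-suc (dist u v) (length v) = s≤s (length≤dist+length u v)
... | no a≢b rewrite dist-∷-≢ u v a≢b = ≤-trans (m≤m+n _ (suc (length v))) (m≤m+n _ (suc (length v)))

length≤length+dist : ∀ u v → length v ≤ length u + dist u v
length≤length+dist [] v = ≤-refl
length≤length+dist (a ∷ u) [] = z≤n
length≤length+dist (a ∷ u) (b ∷ v) with a ℕ.≟ b
... | yes refl rewrite dist-∷-≡ a u v = s≤s (length≤length+dist u v)
... | no a≢b rewrite dist-∷-≢ u v a≢b =
  ≤-trans (m≤n+m (suc (length v)) (suc (length u))) (m≤n+m _ (suc (length u)))

-- Induction on all three sequences at once. Agreeing heads can be stripped from a pair without
-- changing its distance, and a pair with different heads is joined through the root, so its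
-- distance is the sum of the depths.
dist-triangle : ∀ u v w → dist u w ≤ dist u v + dist v w
dist-triangle [] v w = length≤length+dist v w
dist-triangle (a ∷ u) v [] = begin
  dist (a ∷ u) []                ≡⟨ dist-[]ʳ (a ∷ u) ⟩
  length (a ∷ u)                 ≤⟨ length≤dist+length (a ∷ u) v ⟩
  dist (a ∷ u) v + length v      ≡⟨ cong (dist (a ∷ u) v +_) (dist-[]ʳ v) ⟨
  dist (a ∷ u) v + dist v []     ∎
  where open ≤-Reasoning
dist-triangle (a ∷ u) [] (c ∷ w) = begin
  dist (a ∷ u) (c ∷ w)                  ≤⟨ dist≤length+length (a ∷ u) (c ∷ w) ⟩
  length (a ∷ u) + length (c ∷ w)       ≡⟨ cong (_+ length (c ∷ w)) (dist-[]ʳ (a ∷ u)) ⟨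
  dist (a ∷ u) [] + dist [] (c ∷ w)     ∎
  where open ≤-Reasoning
dist-triangle (a ∷ u) (b ∷ v) (c ∷ w) with a ℕ.≟ b | b ℕ.≟ c
... | yes refl | yes refl rewrite dist-∷-≡ a u w | dist-∷-≡ a u v | dist-∷-≡ a v w = dist-triangle u v w
... | yes refl | no b≢c rewrite dist-∷-≢ u w b≢c | dist-∷-≡ a u v | dist-∷-≢ v w b≢c = begin
  suc (length u) + suc (length w)               ≤⟨ s≤s (+-monoˡ-≤ _ (length≤dist+length u v)) ⟩
  suc (dist u v + length v + suc (length w))    ≡⟨ solve 3 (λ x y z → con 1 :+ (x :+ y :+ z) := x :+ (con 1 :+ y :+ z)) refl (dist u v) (length v) (suc (length w)) ⟩
  dist u v + (suc (length v) + suc (length w))  ∎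
  where open ≤-Reasoning; open +-*-Solver
... | no a≢b | yes refl rewrite dist-∷-≢ u w a≢b | dist-∷-≢ u v a≢b | dist-∷-≡ b v w = begin
  suc (length u) + suc (length w)               ≤⟨ +-monoʳ-≤ (suc (length u)) (s≤s (length≤length+dist v w)) ⟩
  suc (length u) + (suc (length v) + dist v w)  ≡⟨ sym (+-assoc (suc (length u)) _ _) ⟩
  suc (length u) + suc (length v) + dist v w    ∎
  where open ≤-Reasoning
... | no a≢b | no b≢c rewrite dist-∷-≢ u v a≢b | dist-∷-≢ v w b≢c =
  ≤-trans (dist≤length+length (a ∷ u) (c ∷ w))
    (+-mono-≤ (m≤m+n (suc (length u)) _) (m≤n+m (suc (length w)) (suc (length v))))

dist-∷ʳ : ∀ u a → dist (u ∷ʳ a) u ≡ 1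
dist-∷ʳ [] a = refl
dist-∷ʳ (b ∷ u) a = trans (dist-∷-≡ b (u ∷ʳ a) u) (dist-∷ʳ u a)

-- Single steps along a path.

parent : Node → Node
parent [] = []
parent (a ∷ []) = []
parent (a ∷ b ∷ u) = a ∷ parent (b ∷ u)

parent-∷ʳ : ∀ a u → ∃ λ b → a ∷ u ≡ parent (a ∷ u) ∷ʳ b
parent-∷ʳ a [] = a , refl
parent-∷ʳ a (b ∷ u) with parent-∷ʳ b u
... | c , eq = c , cong (a ∷_) eq

length-parent : ∀ a u → length (parent (a ∷ u)) ≡ length u
length-parent a [] = refl
length-parent a (b ∷ u) = cong suc (length-parent b u)

-- Junk when the two nodes coincide.
toward : Node → Node → Node
toward [] [] = []
toward [] (b ∷ v) = [ b ]
toward (a ∷ u) [] = parent (a ∷ u)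
toward (a ∷ u) (b ∷ v) with a ℕ.≟ b
... | yes _ = a ∷ toward u v
... | no _ = parent (a ∷ u)

toward-adjacent : ∀ u v → u ≢ v →
  (∃ λ a → toward u v ≡ u ∷ʳ a × (u ∷ʳ a) ≼ v) ⊎ (∃ λ a → u ≡ toward u v ∷ʳ a)
toward-adjacent [] [] u≢v = contradiction refl u≢v
toward-adjacent [] (b ∷ v) _ = inj₁ (b , refl , v , refl)
toward-adjacent (a ∷ u) [] _ = inj₂ (parent-∷ʳ a u)
toward-adjacent (a ∷ u) (b ∷ v) u≢v with a ℕ.≟ b
... | no _ = inj₂ (parent-∷ʳ a u)
... | yes refl with toward-adjacent u v (λ eq → u≢v (cong (a ∷_) eq))
...   | inj₁ (c , eq , p) = inj₁ (c , cong (a ∷_) eq , ≼-cons a p)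
...   | inj₂ (c , eq) = inj₂ (c , cong (a ∷_) eq)

toward-closer : ∀ u v → u ≢ v → suc (dist (toward u v) v) ≤ dist u v
toward-closer [] [] u≢v = contradiction refl u≢v
toward-closer [] (b ∷ v) _ rewrite dist-∷-≡ b [] v = ≤-refl
toward-closer (a ∷ u) [] _ = ≤-reflexive
  (trans (cong suc (trans (dist-[]ʳ (parent (a ∷ u))) (length-parent a u))) (sym (dist-[]ʳ (a ∷ u))))
toward-closer (a ∷ u) (b ∷ v) u≢v with a ℕ.≟ b
... | yes refl rewrite dist-∷-≡ a (toward u v) v | dist-∷-≡ a u v =
  toward-closer u v (λ eq → u≢v (cong (a ∷_) eq))
-- The parent may be the root, where the formula for different heads does not apply; the bound by
-- the sum of the depths is already enough.
... | no a≢b rewrite dist-∷-≢ u v a≢b =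
  s≤s (≤-trans (dist≤length+length (parent (a ∷ u)) (b ∷ v))
    (≤-reflexive (cong (_+ suc (length v)) (length-parent a u))))

-- Counting duplicate-free lists.

lookup-injective : ∀ {A : Set} {xs : List A} → Unique xs → ∀ {i j} → lookup xs i ≡ lookup xs j → i ≡ j
lookup-injective (_ ∷ _) {zero} {zero} _ = refl
lookup-injective (x∉ ∷ _) {zero} {suc j} eq = contradiction eq (All.lookup x∉ (∈-lookup j))
lookup-injective (x∉ ∷ _) {suc i} {zero} eq = contradiction (sym eq) (All.lookup x∉ (∈-lookup i))
lookup-injective (_ ∷ !xs) {suc i} {suc j} eq = cong suc (lookup-injective !xs eq)

-- Pigeonhole: a choice of labels is an injection of positions into `Fin k`. The labels are robots
-- when layers are measured, and positions in the larger list in `length-mono-⊆`.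
length≤labels : ∀ {A : Set} {xs : List A} {k} (Q : A → Fin k → Set) → Unique xs →
  (∀ {x} → x ∈ xs → ∃ (Q x)) →
  (∀ {x y j} → x ∈ xs → y ∈ xs → Q x j → Q y j → x ≡ y) → length xs ≤ k
length≤labels {xs = xs} {k} Q !xs label inj = injective⇒≤ {f = f} f-injective
  where
  f : Fin (length xs) → Fin k
  f i = proj₁ (label (∈-lookup {xs = xs} i))
  f-injective : ∀ {i j} → f i ≡ f j → i ≡ j
  f-injective {i} {j} eq = lookup-injective !xs
    (inj (∈-lookup i) (∈-lookup j) (proj₂ (label (∈-lookup i)))
      (subst (Q _) (sym eq) (proj₂ (label (∈-lookup j)))))

length-mono-⊆ : ∀ {A : Set} {xs ys : List A} → Unique xs → (∀ {x} → x ∈ xs → x ∈ ys) → length xs ≤ length ys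
length-mono-⊆ {ys = ys} !xs xs⊆ys = length≤labels (λ x j → x ≡ lookup ys j) !xs
  (λ x∈ → index (xs⊆ys x∈) , lookup-index (xs⊆ys x∈)) (λ _ _ p q → trans p (sym q))

-- Growing an instance by one layer.

Linked-∷ʳ : ∀ {A : Set} {R : A → A → Set} xs {x y} →
  Linked R (xs ∷ʳ x) → R x y → Linked R ((xs ∷ʳ x) ∷ʳ y)
Linked-∷ʳ [] [-] r = r ∷ [-]
Linked-∷ʳ (_ ∷ []) (p ∷ [-]) r = p ∷ r ∷ [-]
Linked-∷ʳ (_ ∷ z ∷ xs) (p ∷ l) r = p ∷ Linked-∷ʳ (z ∷ xs) l r

inits-∷ʳ : ∀ {A : Set} (xs : List A) x → inits (xs ∷ʳ x) ≡ inits xs ∷ʳ (xs ∷ʳ x)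
inits-∷ʳ [] x = refl
inits-∷ʳ (y ∷ xs) x =
  cong ([] ∷_) (trans (cong (map (y ∷_)) (inits-∷ʳ xs x)) (map-++ (y ∷_) (inits xs) [ xs ∷ʳ x ]))

walkLength-∷ʳ : ∀ us u v → walkLength ((us ∷ʳ u) ∷ʳ v) ≡ walkLength (us ∷ʳ u) + dist u v
walkLength-∷ʳ [] u v = +-identityʳ _
walkLength-∷ʳ (w ∷ []) u v = trans (cong (dist w u +_) (+-identityʳ _)) (cong (_+ dist u v) (sym (+-identityʳ _)))
walkLength-∷ʳ (w ∷ x ∷ us) u v =
  trans (cong (λ n → dist w x + n) (walkLength-∷ʳ (x ∷ us) u v)) (sym (+-assoc (dist w x) _ _))

-- The walk visits the root and then the value of `ℓ` on every nonempty prefix, so one more layer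
-- appends one more node. The earlier layer `L` provides the node from which the last leg starts.
cost-∷ʳ : ∀ ℓ ls L L′ →
  cost ℓ ((ls ∷ʳ L) ∷ʳ L′) ≡ cost ℓ (ls ∷ʳ L) + dist (ℓ (ls ∷ʳ L)) (ℓ ((ls ∷ʳ L) ∷ʳ L′))
cost-∷ʳ ℓ ls L L′ = trans (cong walkLength
    (trans (track-∷ʳ (ls ∷ʳ L) L′) (cong (_∷ʳ ℓ ((ls ∷ʳ L) ∷ʳ L′)) (track-∷ʳ ls L))))
  (trans (walkLength-∷ʳ (track ls) _ _)
    (cong (λ us → walkLength us + dist (ℓ (ls ∷ʳ L)) (ℓ ((ls ∷ʳ L) ∷ʳ L′))) (sym (track-∷ʳ ls L))))
  where
  track : List Layer → List Node
  track ls = root ∷ map ℓ (drop 1 (inits ls))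
  track-∷ʳ : ∀ ls L → track (ls ∷ʳ L) ≡ track ls ∷ʳ ℓ (ls ∷ʳ L)
  track-∷ʳ ls L = cong (root ∷_) (trans (cong (λ xs → map ℓ (drop 1 xs)) (inits-∷ʳ ls L))
    (map-++ ℓ (drop 1 (inits ls)) [ ls ∷ʳ L ]))

-- The depth of an instance.

deepest : ∀ u us → ∃ λ v → v ∈ u ∷ us × (∀ {w} → w ∈ u ∷ us → depth w ≤ depth v)
deepest u [] = u , here refl , λ { (here refl) → ≤-refl }
deepest u (u′ ∷ us) with deepest u′ us
... | v , v∈ , v-max with ≤-total (depth u) (depth v)
...   | inj₁ u≤v = v , there v∈ , λ { (here refl) → u≤v ; (there w∈) → v-max w∈ }
...   | inj₂ v≤u = u , here refl , λ { (here refl) → ≤-refl ; (there w∈) → ≤-trans (v-max w∈) v≤u }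

-- Competitiveness applies only once a depth is exhibited. Ancestors are no deeper than the layer
-- nodes below them, so a deepest layer node attains it; returning that node allows a comparison
-- with the depth of the explored tree.
instanceDepth : ∀ {ls L u} → L ∈ ls → u ∈ L → ∃ λ v → v ∈ concat ls × InstanceDepth ls (depth v)
instanceDepth {ls} {L} {u} L∈ u∈ with concat ls in eq
... | [] = contradiction (subst (u ∈_) eq (∈-concat⁺′ u∈ L∈)) λ ()
... | w ∷ ws with deepest w ws
...   | v , v∈ , v-max = v , v∈ ,
  (λ { x (L′ , L′∈ , y , y∈ , x≼y) → ≤-trans (≼-depth x≼y) (v-max (subst (y ∈_) eq (∈-concat⁺′ y∈ L′∈))) }) ,
  v , in-underlying (∈-concat⁻′ ls (subst (v ∈_) (sym eq) v∈)) , refl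
  where
  in-underlying : (∃ λ L′ → v ∈ L′ × L′ ∈ ls) → InUnderlying ls v
  in-underlying (L′ , v∈L′ , L′∈) = L′ , L′∈ , v , v∈L′ , ≼-refl

-- Natural numbers inside the rationals.

-- `_/_` normalises and so does not compute on a variable. The unnormalised fraction is explicit,
-- and the arithmetic of `ℕ→ℚ` is reduced to it.
toℚᵘ-ℕ→ℚ : ∀ m → ℚ.toℚᵘ (ℕ→ℚ m) ℚᵘ.≃ ℚᵘ.mkℚᵘ (ℤ.+ m) 0
toℚᵘ-ℕ→ℚ m = ℚ.toℚᵘ-fromℚᵘ (ℚᵘ.mkℚᵘ (ℤ.+ m) 0)

ℕ→ℚ-homo-+ : ∀ m n → ℕ→ℚ (m + n) ≡ ℕ→ℚ m ℚ.+ ℕ→ℚ n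
ℕ→ℚ-homo-+ m n = ℚ.toℚᵘ-injective (begin-equality
  ℚ.toℚᵘ (ℕ→ℚ (m + n))                      ≃⟨ toℚᵘ-ℕ→ℚ (m + n) ⟩
  ℚᵘ.mkℚᵘ (ℤ.+ (m + n)) 0                     ≃⟨ ℚᵘ.*≡* (cong (ℤ._* ℤ.1ℤ) (cong₂ ℤ._+_ (sym (ℤ.*-identityʳ (ℤ.+ m))) (sym (ℤ.*-identityʳ (ℤ.+ n))))) ⟩
  ℚᵘ.mkℚᵘ (ℤ.+ m) 0 ℚᵘ.+ ℚᵘ.mkℚᵘ (ℤ.+ n) 0      ≃⟨ ℚᵘ.+-cong (toℚᵘ-ℕ→ℚ m) (toℚᵘ-ℕ→ℚ n) ⟨
  ℚ.toℚᵘ (ℕ→ℚ m) ℚᵘ.+ ℚ.toℚᵘ (ℕ→ℚ n)        ≃⟨ ℚ.toℚᵘ-homo-+ (ℕ→ℚ m) (ℕ→ℚ n) ⟨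
  ℚ.toℚᵘ (ℕ→ℚ m ℚ.+ ℕ→ℚ n)                  ∎)
  where open ℚᵘ.≤-Reasoning

ℕ→ℚ-mono-≤ : ∀ {m n} → m ≤ n → ℕ→ℚ m ℚ.≤ ℕ→ℚ n
ℕ→ℚ-mono-≤ {m} {n} m≤n = ℚ.toℚᵘ-cancel-≤ (begin
  ℚ.toℚᵘ (ℕ→ℚ m)      ≃⟨ toℚᵘ-ℕ→ℚ m ⟩
  ℚᵘ.mkℚᵘ (ℤ.+ m) 0     ≤⟨ ℚᵘ.*≤* (ℤ.*-monoʳ-≤-nonNeg ℤ.1ℤ (ℤ.+≤+ m≤n)) ⟩
  ℚᵘ.mkℚᵘ (ℤ.+ n) 0     ≃⟨ toℚᵘ-ℕ→ℚ n ⟨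
  ℚ.toℚᵘ (ℕ→ℚ n)      ∎)
  where open ℚᵘ.≤-Reasoning

ℕ→ℚ-cancel-≤ : ∀ {m n} → ℕ→ℚ m ℚ.≤ ℕ→ℚ n → m ≤ n
ℕ→ℚ-cancel-≤ {m} {n} h = ℤ.drop‿+≤+ (ℤ.*-cancelʳ-≤-pos (ℤ.+ m) (ℤ.+ n) ℤ.1ℤ (ℚᵘ.drop-*≤* (begin
  ℚᵘ.mkℚᵘ (ℤ.+ m) 0     ≃⟨ toℚᵘ-ℕ→ℚ m ⟨
  ℚ.toℚᵘ (ℕ→ℚ m)      ≤⟨ ℚ.toℚᵘ-mono-≤ h ⟩
  ℚ.toℚᵘ (ℕ→ℚ n)      ≃⟨ toℚᵘ-ℕ→ℚ n ⟩
  ℚᵘ.mkℚᵘ (ℤ.+ n) 0     ∎)))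
  where open ℚᵘ.≤-Reasoning

-- The numerator bounds a nonnegative fraction, as the denominator is at least one. The result
-- selects a round beyond the claimed bound.
archimedean : ∀ q → ∃ λ n → q ℚ.≤ ℕ→ℚ n
archimedean q@(ℚ.mkℚ (ℤ.+ n) d-1 _) = n , ℚ.toℚᵘ-cancel-≤ (begin
  ℚᵘ.mkℚᵘ (ℤ.+ n) d-1     ≤⟨ ℚᵘ.*≤* (ℤ.*-monoˡ-≤-nonNeg (ℤ.+ n) (ℤ.+≤+ (s≤s z≤n))) ⟩
  ℚᵘ.mkℚᵘ (ℤ.+ n) 0       ≃⟨ toℚᵘ-ℕ→ℚ n ⟨
  ℚ.toℚᵘ (ℕ→ℚ n)        ∎)
  where open ℚᵘ.≤-Reasoning
archimedean q@(ℚ.mkℚ (ℤ.-[1+ n ]) d-1 _) = 0 , ℚ.<⇒≤ (ℚ.negative⁻¹ q)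

-- Sums over the robots.

sum-mono-≤ : ∀ {k} {f g : Fin k → ℕ} → (∀ i → f i ≤ g i) → sum f ≤ sum g
sum-mono-≤ {zero} _ = z≤n
sum-mono-≤ {suc k} le = +-mono-≤ (le zero) (sum-mono-≤ (λ i → le (suc i)))

updFin-≢ : ∀ {k} {X : Set} (f : Fin k → X) {i j} x → j ≢ i → updFin f i x j ≡ f j
updFin-≢ f {i} {j} x j≢i with j Fin.≟ i
... | yes j≡i = contradiction j≡i j≢i
... | no _ = refl

sum-updFin : ∀ {k} (f : Fin k → ℕ) i → sum (updFin f i (suc (f i))) ≡ suc (sum f)
sum-updFin {suc k} f zero = cong (suc (f zero) +_) (sum-cong-≗ (λ j → updFin-≢ f {zero} {suc j} (suc (f zero)) λ ()))
sum-updFin {suc k} f (suc i) = trans (cong (f zero +_) (trans (sum-cong-≗ shift) (sum-updFin (λ j → f (suc j)) i)))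
  (+-suc (f zero) _)
  where
  shift : ∀ j → updFin f (suc i) (suc (f (suc i))) (suc j) ≡ updFin (λ j → f (suc j)) i (suc (f (suc i))) j
  shift j with j Fin.≟ i
  ... | yes _ = refl
  ... | no _ = refl

ℕ→ℚ-sum-≤ : ∀ {k} (f : Fin k → ℕ) q → (∀ i → ℕ→ℚ (f i) ℚ.≤ q) → ℕ→ℚ (sum f) ℚ.≤ ℕ→ℚ k ℚ.* q
ℕ→ℚ-sum-≤ {zero} f q _ = ℚ.≤-reflexive (sym (ℚ.*-zeroˡ q))
ℕ→ℚ-sum-≤ {suc k} f q le = begin
  ℕ→ℚ (f zero + sum g)               ≡⟨ ℕ→ℚ-homo-+ (f zero) (sum g) ⟩
  ℕ→ℚ (f zero) ℚ.+ ℕ→ℚ (sum g)       ≤⟨ ℚ.+-mono-≤ (le zero) (ℕ→ℚ-sum-≤ g q (λ i → le (suc i))) ⟩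
  q ℚ.+ ℕ→ℚ k ℚ.* q                     ≡⟨ cong (ℚ._+ ℕ→ℚ k ℚ.* q) (ℚ.*-identityˡ q) ⟨
  ℚ.1ℚ ℚ.* q ℚ.+ ℕ→ℚ k ℚ.* q            ≡⟨ ℚ.*-distribʳ-+ q ℚ.1ℚ (ℕ→ℚ k) ⟨
  (ℚ.1ℚ ℚ.+ ℕ→ℚ k) ℚ.* q                ≡⟨ cong (ℚ._* q) (ℕ→ℚ-homo-+ 1 k) ⟨
  ℕ→ℚ (suc k) ℚ.* q                     ∎
  where
  open ℚ.≤-Reasoning
  g : Fin k → ℕ
  g i = f (suc i)

-- Knowledge and its frontier.

_≟ₙ_ : (u v : Node) → Dec (u ≡ v)
_≟ₙ_ = ≡-dec ℕ._≟_

open import Data.List.Membership.DecPropositional _≟ₙ_ using (_∈?_)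
open import Data.List.Relation.Unary.Unique.DecPropositional.Properties _≟ₙ_ using (deduplicate-!)

-- A node is mined once a robot at that node has found all of its child edges taken.
record Knowledge : Set where
  constructor knowing
  field
    mined known : List Node

open Knowledge

_∪_ : Knowledge → Knowledge → Knowledge
K ∪ K′ = knowing (mined K ++ mined K′) (known K ++ known K′)

mine : Node → List Node → Knowledge → Knowledge
mine p kids K = knowing (p ∷ mined K) (kids ++ known K)

-- `inits v` contains `v` itself, whence the alternative `u ≡ v`; only proper ancestors have to be
-- mined. Quantifying over this finite list keeps the predicate decidable.
TopmostUnmined : List Node → Node → Set
TopmostUnmined M v = v ∉ M × All (λ u → u ≡ v ⊎ u ∈ M) (inits v)

topmostUnmined? : ∀ M → Decidable (TopmostUnmined M)
topmostUnmined? M v = ¬? (v ∈? M) ×-dec All.all? (λ u → (u ≟ₙ v) ⊎-dec (u ∈? M)) (inits v)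

-- Merging concatenates lists, so `known` may repeat nodes, which a layer must not do.
frontier : Knowledge → Layer
frontier K = filter (topmostUnmined? (mined K)) (deduplicate _≟ₙ_ (known K))

initialKnowledge : Knowledge
initialKnowledge = knowing [] [ root ]

-- Descend from the root towards `v` and stop at the first unmined node; `go u w` maintains that all
-- proper ancestors of `u` are mined.
topmostUnmined-prefix : ∀ {M v} → v ∉ M → ∃ λ u → u ≼ v × TopmostUnmined M u
topmostUnmined-prefix {M} v∉ = go [] _ v∉ (inj₁ refl ∷ [])
  where
  extend : ∀ {u a} → u ∈ M → All (λ w → w ≡ u ⊎ w ∈ M) (inits u) → All (λ w → w ≡ u ∷ʳ a ⊎ w ∈ M) (inits (u ∷ʳ a))
  extend {u} {a} u∈ above = All.tabulate λ w∈ → case-prefix (≼-∷ʳ⁻ (∈inits⇒≼ (u ∷ʳ a) w∈))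
    where
    case-prefix : ∀ {w} → w ≡ u ∷ʳ a ⊎ w ≼ u → w ≡ u ∷ʳ a ⊎ w ∈ M
    case-prefix (inj₁ eq) = inj₁ eq
    case-prefix (inj₂ w≼u) = inj₂ ([ (λ { refl → u∈ }) , (λ w∈ → w∈) ]′ (All.lookup above (≼⇒∈inits w≼u)))
  go : ∀ u w → (u ++ w) ∉ M → All (λ x → x ≡ u ⊎ x ∈ M) (inits u) → ∃ λ x → x ≼ (u ++ w) × TopmostUnmined M x
  go u w v∉ above with u ∈? M
  ... | no u∉ = u , (w , refl) , u∉ , above
  go u [] v∉ above | yes u∈ = contradiction (subst (_∈ M) (sym (++-identityʳ u)) u∈) v∉
  go u (a ∷ w) v∉ above | yes u∈ with go (u ∷ʳ a) w (v∉ ∘ subst (_∈ M) (++-assoc u [ a ] w)) (extend u∈ above)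
  ... | x , x≼ , top = x , subst (x ≼_) (++-assoc u [ a ] w) x≼ , top

frontier⁻ : ∀ K {v} → v ∈ frontier K → v ∈ known K × TopmostUnmined (mined K) v
frontier⁻ K v∈ with ∈-filter⁻ (topmostUnmined? (mined K)) v∈
... | v∈′ , top = ∈-deduplicate⁻ _≟ₙ_ (known K) v∈′ , top

frontier⁺ : ∀ K {v} → v ∈ known K → TopmostUnmined (mined K) v → v ∈ frontier K
frontier⁺ K v∈ top = ∈-filter⁺ (topmostUnmined? (mined K)) (∈-deduplicate⁺ _≟ₙ_ v∈) top

topmostUnmined-antichain : ∀ {M u v} → TopmostUnmined M u → TopmostUnmined M v → u ≼ v → u ≡ v
topmostUnmined-antichain (u∉ , _) (_ , above) u≼v with All.lookup above (≼⇒∈inits u≼v)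
... | inj₁ eq = eq
... | inj₂ u∈ = contradiction u∈ u∉

topmostUnmined-∷ʳ : ∀ {M u a} → TopmostUnmined M (u ∷ʳ a) → u ∈ M
topmostUnmined-∷ʳ {u = u} {a} (_ , above) with All.lookup above (≼⇒∈inits (≼-∷ʳ {u} a))
... | inj₂ u∈ = u∈
... | inj₁ eq = contradiction (cong length eq)
  (λ h → m≢1+n+m (length u) {0} (trans h (trans (length-++ u) (+-comm (length u) 1))))

frontier-isLayer : ∀ K → IsLayer (frontier K)
frontier-isLayer K = Unique-filter⁺ (topmostUnmined? (mined K)) (deduplicate-! (known K)) ,
  λ u∈ v∈ → topmostUnmined-antichain (proj₂ (frontier⁻ K u∈)) (proj₂ (frontier⁻ K v∈))

-- The exploration algorithm.

-- `step` is not told where the robot stands, so the memory carries the position. Each robot feeds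
-- `ℓ` an instance of its own, `layers`, whose last layer is always the frontier of its `knowledge`.
record Memory : Set where
  constructor memory
  field
    position  : Node
    knowledge : Knowledge
    layers    : List Layer

record Whiteboard : Set where
  constructor whiteboard
  field
    taken     : List Node
    knowledge : Knowledge

open Memory
open Whiteboard renaming (knowledge to posted)

children : Node → List Node → List Node
children p nb = filterᵇ (isChildᵇ p) nb

untaken : Whiteboard → List Node → List Node
untaken b = filter (λ v → ¬? (v ∈? taken b))

module Exploration (ℓ : TraversalFn) where

  -- Posting the robot's knowledge beside the new mark ensures that whoever reads the mark also
  -- learns what the robot knew to be mined. Its own knowledge stays fixed, so the last layer shown
  -- to `ℓ` remains its frontier.
  takeEdge : Node → Memory → Whiteboard → Memory × Whiteboard × Node
  takeEdge v m b =
    memory v (knowledge m) (layers m) , whiteboard (v ∷ taken b) (knowledge m ∪ posted b) , v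

  mineAndMove : Node → Memory → Whiteboard → List Node → Memory × Whiteboard × Node
  mineAndMove p m b kids =
    let K  = mine p kids (knowledge m ∪ posted b)
        ls = layers m ∷ʳ frontier K
        -- `p` is mined in `K` and hence outside the frontier, so a target chosen in the frontier
        -- differs from `p` and the step is genuine.
        q  = toward p (ℓ ls)
    in memory q K ls , whiteboard (taken b) K , q

  decide : Node → Memory → Whiteboard → List Node → List Node → Memory × Whiteboard × Node
  decide p m b kids [] = mineAndMove p m b kids
  decide p m b kids (v ∷ _) = takeEdge v m b

  act : Node → Memory → Whiteboard → List Node → Memory × Whiteboard × Node
  act p m b nb = decide p m b (children p nb) (untaken b (children p nb))

  explorer : DACTE
  explorer = record
    { Mem    = Memory
    ; Board  = Whiteboard
    -- The instance starts with the layer of the root alone, so there is a current target from the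
    -- outset.
    ; mem₀   = memory root initialKnowledge [ frontier initialKnowledge ]
    ; board₀ = whiteboard [] initialKnowledge
    ; step   = λ m b nb → act (position m) m b nb
    }

module Correctness {k : ℕ} (ℓ : TraversalFn) (traversal : IsTraversal ℓ)
                   {tree : List Node} (finite : IsFiniteTree tree) where

  open Exploration ℓ

  -- Neighbourhoods in the explored tree.

  tree-prefix : ∀ {u v} → u ≼ v → v ∈ tree → u ∈ tree
  tree-prefix {u} (w , refl) v∈ = go u w v∈
    where
    go : ∀ u w → (u ++ w) ∈ tree → u ∈ tree
    go u [] v∈ = subst (_∈ tree) (++-identityʳ u) v∈
    go u (a ∷ w) v∈ = proj₂ (proj₂ finite) u a (go (u ∷ʳ a) w (subst (_∈ tree) (sym (++-assoc u [ a ] w)) v∈))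

  children⁺ : ∀ {p a} → (p ∷ʳ a) ∈ tree → (p ∷ʳ a) ∈ children p (neighbours tree p)
  children⁺ {p} {a} v∈ = ∈-filter⁺ _ (∈-filter⁺ _ v∈ (Equivalence.from T-∨ (inj₁ (isChild⁺ p a)))) (isChild⁺ p a)

  children⁻ : ∀ {p v} → v ∈ children p (neighbours tree p) →
    v ∈ neighbours tree p × v ∈ tree × ∃ λ a → v ≡ p ∷ʳ a
  children⁻ {p} {v} v∈ with ∈-filter⁻ _ v∈
  ... | v∈nb , child = v∈nb , proj₁ (∈-filter⁻ _ {xs = tree} v∈nb) , isChild⁻ p v child

  parent∈neighbours : ∀ {p q a} → p ∈ tree → p ≡ q ∷ʳ a → q ∈ neighbours tree p
  parent∈neighbours {q = q} {a} p∈ refl =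
    ∈-filter⁺ _ (tree-prefix (≼-∷ʳ a) p∈) (Equivalence.from T-∨ (inj₂ (isChild⁺ q a)))

  -- A robot's first traversal of the edge above `node`; `saw` is what its owner knew to be mined then.
  record Entry : Set where
    constructor entry
    field
      node  : Node
      owner : Fin k
      saw   : List Node

  open Entry

  -- Soundness of knowledge.

  -- The inclusion of `saw e` in `M` encodes that news of a taken edge comes together with what the
  -- edge's owner knew to be mined when crossing it.
  TakenWithin : List Entry → List Node → Node → Set
  TakenWithin R M v = ∃ λ e → e ∈ R × node e ≡ v × (∀ {w} → w ∈ saw e → w ∈ M)

  TakenWithin-mono : ∀ {R R′ M M′ v} → (∀ {e} → e ∈ R → e ∈ R′) → (∀ {w} → w ∈ M → w ∈ M′) →
    TakenWithin R M v → TakenWithin R′ M′ v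
  TakenWithin-mono R⊆ M⊆ (e , e∈ , eq , saw⊆) = e , R⊆ e∈ , eq , M⊆ ∘ saw⊆

  -- `root-known` and `children-known` make every topmost unmined tree node known, so the frontier
  -- misses none; `children-taken` provides the owner of a frontier node other than the root.
  record Sound (R : List Entry) (Visited : Node → Set) (K : Knowledge) : Set where
    field
      known⊆tree     : ∀ {v} → v ∈ known K → v ∈ tree
      root-known     : root ∈ known K
      mined-visited  : ∀ {u} → u ∈ mined K → Visited u
      children-known : ∀ {u a} → u ∈ mined K → (u ∷ʳ a) ∈ tree → (u ∷ʳ a) ∈ known K
      children-taken : ∀ {u a} → u ∈ mined K → (u ∷ʳ a) ∈ tree → TakenWithin R (mined K) (u ∷ʳ a)

  open Sound

  Sound-mono : ∀ {R R′ V V′ K} → (∀ {e} → e ∈ R → e ∈ R′) → (∀ {u} → V u → V′ u) → Sound R V K → Sound R′ V′ K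
  Sound-mono R⊆ V⊆ S = record
    { known⊆tree     = known⊆tree S
    ; root-known     = root-known S
    ; mined-visited  = V⊆ ∘ mined-visited S
    ; children-known = children-known S
    ; children-taken = λ u∈ v∈ → TakenWithin-mono R⊆ (λ w∈ → w∈) (children-taken S u∈ v∈)
    }

  Sound-initial : ∀ {R V} → Sound R V initialKnowledge
  Sound-initial = record
    { known⊆tree     = λ { (here refl) → proj₁ (proj₂ finite) }
    ; root-known     = here refl
    ; mined-visited  = λ ()
    ; children-known = λ ()
    ; children-taken = λ ()
    }

  Sound-∪ : ∀ {R V K K′} → Sound R V K → Sound R V K′ → Sound R V (K ∪ K′)
  Sound-∪ {K = K} {K′} S S′ = record
    { known⊆tree     = [ known⊆tree S , known⊆tree S′ ]′ ∘ ∈-++⁻ (known K)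
    ; root-known     = ∈-++⁺ˡ (root-known S)
    ; mined-visited  = [ mined-visited S , mined-visited S′ ]′ ∘ ∈-++⁻ (mined K)
    ; children-known = λ u∈ v∈ → [ (λ u∈ → ∈-++⁺ˡ (children-known S u∈ v∈))
                                 , (λ u∈ → ∈-++⁺ʳ (known K) (children-known S′ u∈ v∈)) ]′ (∈-++⁻ (mined K) u∈)
    ; children-taken = λ u∈ v∈ → [ (λ u∈ → TakenWithin-mono (λ e∈ → e∈) ∈-++⁺ˡ (children-taken S u∈ v∈))
                                 , (λ u∈ → TakenWithin-mono (λ e∈ → e∈) (∈-++⁺ʳ (mined K)) (children-taken S′ u∈ v∈))
                                 ]′ (∈-++⁻ (mined K) u∈)
    }

  Sound-mine : ∀ {R V K p} → V p → (∀ {a} → (p ∷ʳ a) ∈ tree → TakenWithin R (mined K) (p ∷ʳ a)) →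
    Sound R V K → Sound R V (mine p (children p (neighbours tree p)) K)
  Sound-mine {R} {V} {K} {p} Vp all-taken S = record
    { known⊆tree     = [ (λ v∈ → proj₁ (proj₂ (children⁻ {p} v∈))) , known⊆tree S ]′ ∘ ∈-++⁻ kids
    ; root-known     = ∈-++⁺ʳ kids (root-known S)
    ; mined-visited  = λ { (here refl) → Vp ; (there u∈) → mined-visited S u∈ }
    ; children-known = λ { (here refl) v∈ → ∈-++⁺ˡ (children⁺ v∈)
                         ; (there u∈) v∈ → ∈-++⁺ʳ kids (children-known S u∈ v∈) }
    ; children-taken = λ { (here refl) v∈ → TakenWithin-mono (λ e∈ → e∈) there (all-taken v∈)
                         ; (there u∈) v∈ → TakenWithin-mono (λ e∈ → e∈) there (children-taken S u∈ v∈) }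
    }
    where
    kids : List Node
    kids = children p (neighbours tree p)

  -- The topmost unmined ancestor of `v` is the root or the child of a mined node, and is known in
  -- either case.
  frontier-covers : ∀ {R V K v} → Sound R V K → v ∈ tree → v ∉ mined K → ∃ λ u → u ∈ frontier K × u ≼ v
  frontier-covers {K = K} S v∈ v∉ with topmostUnmined-prefix v∉
  ... | u , u≼v , top = u , frontier⁺ K (is-known u (tree-prefix u≼v v∈) top) top , u≼v
    where
    is-known : ∀ u → u ∈ tree → TopmostUnmined (mined K) u → u ∈ known K
    is-known u u∈ top with initLast u
    ... | [] = root-known S
    ... | u′ ∷ʳ′ a = children-known S (topmostUnmined-∷ʳ top) u∈

  -- A node unmined under the larger knowledge is unmined under the smaller one, whose frontier
  -- therefore covers it.
  frontier-⪰ : ∀ {R R′ V V′ K K′} → Sound R V K → Sound R′ V′ K′ →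
    (∀ {u} → u ∈ mined K → u ∈ mined K′) → frontier K ⪰ₗ frontier K′
  frontier-⪰ {K′ = K′} S S′ M⊆ v∈ with frontier⁻ K′ v∈
  ... | v-known , v∉ , _ = frontier-covers S (known⊆tree S′ v-known) (v∉ ∘ M⊆)

  frontier-empty⇒visited : ∀ {R V K} → Sound R V K → frontier K ≡ [] → ∀ u → u ∈ tree → V u
  frontier-empty⇒visited {K = K} S empty u u∈ with u ∈? mined K
  ... | yes u∈M = mined-visited S u∈M
  ... | no u∉M with frontier-covers S u∈ u∉M
  ...   | w , w∈ , _ = contradiction (subst (w ∈_) empty w∈) λ ()

  -- The ledger of first crossings and the width of layers.

  -- For an earlier and a later entry of one robot: at the later crossing it was still below the
  -- earlier node, or knew that node to be mined.
  Precedes : Entry → Entry → Set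
  Precedes e e′ = node e ≼ node e′ ⊎ node e ∈ saw e′

  -- No edge lies above the root, so `root-taken` provides a fictitious entry that saw nothing, and
  -- the root has an owner like every other frontier node.
  record Ledger (R : List Entry) : Set where
    field
      nodes-unique : Unique (map node R)
      nodes⊆tree   : ∀ {e} → e ∈ R → node e ∈ tree
      comparable   : ∀ {e e′} → e ∈ R → e′ ∈ R → owner e ≡ owner e′ → Precedes e e′ ⊎ Precedes e′ e
      root-taken   : TakenWithin R [] root

  open Ledger

  length-ledger : ∀ {R} → Ledger R → length R ≤ length tree
  length-ledger {R} Λ = subst (_≤ length tree) (length-map node R)
    (length-mono-⊆ (nodes-unique Λ) λ v∈ → in-tree (∈-map⁻ node v∈))
    where
    in-tree : ∀ {v} → (∃ λ e → e ∈ R × v ≡ node e) → v ∈ tree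
    in-tree (e , e∈ , refl) = nodes⊆tree Λ e∈

  -- Frontier nodes are labelled by owners. If two of them share an owner, one entry precedes the
  -- other: a prefix forces equality in an antichain, while membership in `saw` would make a
  -- frontier node mined.
  frontier-width : ∀ {R V K} → Ledger R → Sound R V K → length (frontier K) ≤ k
  frontier-width {R} {V} {K} Λ S =
    length≤labels Q (proj₁ (frontier-isLayer K)) (λ {v} v∈ → label v (frontier⁻ K v∈)) Q-injective
    where
    Q : Node → Fin k → Set
    Q v j = ∃ λ e → e ∈ R × node e ≡ v × owner e ≡ j × (∀ {w} → w ∈ saw e → w ∈ mined K)
    label : ∀ v → v ∈ known K × TopmostUnmined (mined K) v → ∃ (Q v)
    label v (v-known , top) with initLast v
    label _ _ | [] with root-taken Λ
    ... | e , e∈ , eq , saw⊆ = owner e , e , e∈ , eq , refl , λ w∈ → contradiction (saw⊆ w∈) λ ()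
    label _ (v-known , top) | u ∷ʳ′ a with children-taken S (topmostUnmined-∷ʳ top) (known⊆tree S v-known)
    ... | e , e∈ , eq , saw⊆ = owner e , e , e∈ , eq , refl , saw⊆
    Precedes⇒≡ : ∀ {e e′} → Precedes e e′ → (∀ {w} → w ∈ saw e′ → w ∈ mined K) →
      node e ∈ frontier K → node e′ ∈ frontier K → node e ≡ node e′
    Precedes⇒≡ (inj₁ e≼e′) _ e∈ e′∈ = proj₂ (frontier-isLayer K) e∈ e′∈ e≼e′
    Precedes⇒≡ (inj₂ e-saw) saw⊆ e∈ _ = contradiction (saw⊆ e-saw) (proj₁ (proj₂ (frontier⁻ K e∈)))
    Q-injective : ∀ {u v j} → u ∈ frontier K → v ∈ frontier K → Q u j → Q v j → u ≡ v
    Q-injective u∈ v∈ (e , e∈ , refl , refl , saw⊆) (e′ , e′∈ , refl , eq , saw′⊆)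
      with comparable Λ e∈ e′∈ (sym eq)
    ... | inj₁ prec = Precedes⇒≡ {e} {e′} prec saw′⊆ u∈ v∈
    ... | inj₂ prec = sym (Precedes⇒≡ {e′} {e} prec saw⊆ v∈ u∈)

  -- The invariants of robots, whiteboards and configurations.

  -- `account` is an amortised bound whose potential is the distance to the current target; `fresh`
  -- counts the edges this robot crossed first. `owned` says that the subtree of an owned node is
  -- left only with the knowledge that this node is mined. `in-tree` will bound the depth of the
  -- instance.
  record RobotInv (R : List Entry) (Visited : Node → Set) (j : Fin k) (p : Node) (m : Memory)
                  (moves fresh : ℕ) : Set where
    field
      position≡   : position m ≡ p
      pos∈tree    : p ∈ tree
      sound       : Sound R Visited (knowledge m)
      last-layer  : ∃ λ ls → layers m ≡ ls ∷ʳ frontier (knowledge m)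
      is-instance : IsInstance (layers m)
      width       : WidthAtMost k (layers m)
      in-tree     : All (All (_∈ tree)) (layers m)
      account     : moves + dist p (ℓ (layers m)) ≤ 2 * fresh + cost ℓ (layers m)
      owned       : ∀ {e} → e ∈ R → owner e ≡ j → node e ≼ p ⊎ node e ∈ mined (knowledge m)

  open RobotInv

  -- `taken-complete` makes an unmarked child edge truly new; `taken-sound` makes a marked one
  -- usable as evidence for mining `u`.
  record BoardInv (R : List Entry) (Visited : Node → Set) (u : Node) (b : Whiteboard) : Set where
    field
      posted-sound   : Sound R Visited (posted b)
      taken-sound    : ∀ {v} → v ∈ taken b → TakenWithin R (mined (posted b)) v
      taken-complete : ∀ {e a} → e ∈ R → node e ≡ u ∷ʳ a → node e ∈ taken b

  open BoardInv

  record Inv (Visited : Node → Set) (s : ℕ) (c : Config explorer k) : Set where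
    field
      {R}         : List Entry
      ledger      : Ledger R
      moves fresh : Fin k → ℕ
      moves-sum   : sum moves ≡ s
      -- The extra one is the fictitious entry of the root.
      fresh-sum   : suc (sum fresh) ≡ length R
      robots      : ∀ j → RobotInv R Visited j (pos c j) (mem c j) (moves j) (fresh j)
      boards      : ∀ u → BoardInv R Visited u (board c u)

  -- `round` with the outcome of the activation as a parameter, so that the two kinds of move can be
  -- treated separately.
  apply : Config explorer k → Fin k → Memory × Whiteboard × Node → Config explorer k
  apply c i o = record
    { pos   = updFin (pos c) i (proj₂ (proj₂ o))
    ; mem   = updFin (mem c) i (proj₁ o)
    ; board = updNode (board c) (pos c i) (proj₁ (proj₂ o))
    }

  -- Crossing a new edge.

  takeEdge-preserves : ∀ {V V′ s c i v} → Inv V s c → (∀ {u} → V u → V′ u) →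
    v ∈ children (pos c i) (neighbours tree (pos c i)) → v ∉ taken (board c (pos c i)) →
    Inv V′ (suc s) (apply c i (takeEdge v (mem c i) (board c (pos c i))))
  takeEdge-preserves {V} {V′} {s} {c} {i} {v} I V⊆ v∈kids v∉taken = record
    { R         = R′
    ; ledger    = record
      { nodes-unique = ¬Any⇒All¬ _ v∉R ∷ nodes-unique ledger
      ; nodes⊆tree   = λ { (here refl) → v∈tree ; (there e∈) → nodes⊆tree ledger e∈ }
      ; comparable   = λ { (here refl) (here refl) _ → inj₁ (inj₁ ≼-refl)
                         ; (here refl) (there e∈) eq → inj₂ (new-last e∈ (sym eq))
                         ; (there e∈) (here refl) eq → inj₁ (new-last e∈ eq)
                         ; (there e∈) (there e′∈) eq → comparable ledger e∈ e′∈ eq }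
      ; root-taken   = TakenWithin-mono there (λ w∈ → w∈) (root-taken ledger)
      }
    ; moves     = updFin moves i (suc (moves i))
    ; fresh     = updFin fresh i (suc (fresh i))
    ; moves-sum = trans (sum-updFin moves i) (cong suc moves-sum)
    ; fresh-sum = cong suc (trans (sum-updFin fresh i) fresh-sum)
    ; robots    = robots′
    ; boards    = boards′
    }
    where
    open Inv I
    p : Node
    p = pos c i
    m : Memory
    m = mem c i
    b : Whiteboard
    b = board c p
    e₀ : Entry
    e₀ = entry v i (mined (knowledge m))
    R′ : List Entry
    R′ = e₀ ∷ R
    v∈tree : v ∈ tree
    v∈tree = proj₁ (proj₂ (children⁻ {p} v∈kids))
    v-child : ∃ λ a → v ≡ p ∷ʳ a
    v-child = proj₂ (proj₂ (children⁻ {p} v∈kids))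
    p≼v : p ≼ v
    p≼v = proj₁ v-child ∷ [] , sym (proj₂ v-child)
    v∉R : v ∉ map node R
    v∉R v∈ with ∈-map⁻ node v∈
    ... | e , e∈ , refl = v∉taken (taken-complete (boards p) e∈ (proj₂ v-child))
    -- `owned` has just the form required: what the robot is below stays above `v`, and what it
    -- knows to be mined is `saw e₀`.
    new-last : ∀ {e} → e ∈ R → owner e ≡ i → Precedes e e₀
    new-last e∈ eq with owned (robots i) e∈ eq
    ... | inj₁ e≼p = inj₁ (≼-trans e≼p p≼v)
    ... | inj₂ e∈M = inj₂ e∈M
    lift : ∀ {K} → Sound R V K → Sound R′ V′ K
    lift = Sound-mono there V⊆
    -- Each new edge earns two: one pays for the move, the other for a possible increase of the
    -- distance to the unchanged target.
    accounting : suc (moves i) + dist v (ℓ (layers m)) ≤ 2 * suc (fresh i) + cost ℓ (layers m)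
    accounting = begin
      suc (moves i) + dist v t                ≤⟨ +-monoʳ-≤ (suc (moves i)) (dist-triangle v p t) ⟩
      suc (moves i) + (dist v p + dist p t)   ≡⟨ cong (λ n → suc (moves i) + (n + dist p t)) v-dist ⟩
      suc (moves i) + (1 + dist p t)          ≡⟨ solve 2 (λ x y → con 1 :+ x :+ (con 1 :+ y) := con 2 :+ (x :+ y)) refl (moves i) (dist p t) ⟩
      2 + (moves i + dist p t)                ≤⟨ +-monoʳ-≤ 2 (account (robots i)) ⟩
      2 + (2 * fresh i + cost ℓ (layers m))   ≡⟨ solve 2 (λ x y → con 2 :+ (con 2 :* x :+ y) := con 2 :* (con 1 :+ x) :+ y) refl (fresh i) (cost ℓ (layers m)) ⟩
      2 * suc (fresh i) + cost ℓ (layers m)   ∎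
      where
      open ≤-Reasoning
      open +-*-Solver
      t : Node
      t = ℓ (layers m)
      v-dist : dist v p ≡ 1
      v-dist = trans (cong (λ x → dist x p) (proj₂ v-child)) (dist-∷ʳ p (proj₁ v-child))
    robots′ : ∀ j → RobotInv R′ V′ j (updFin (pos c) i v j)
      (updFin (mem c) i (memory v (knowledge m) (layers m)) j)
      (updFin moves i (suc (moves i)) j) (updFin fresh i (suc (fresh i)) j)
    robots′ j with j Fin.≟ i
    ... | yes refl = record
      { position≡   = refl
      ; pos∈tree    = v∈tree
      ; sound       = lift (sound (robots i))
      ; last-layer  = last-layer (robots i)
      ; is-instance = is-instance (robots i)
      ; width       = width (robots i)
      ; in-tree     = in-tree (robots i)
      ; account     = accounting
      ; owned       = λ { (here refl) _ → inj₁ ≼-refl ; (there e∈) eq → new-last e∈ eq }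
      }
    ... | no j≢i = record
      { position≡   = position≡ (robots j)
      ; pos∈tree    = pos∈tree (robots j)
      ; sound       = lift (sound (robots j))
      ; last-layer  = last-layer (robots j)
      ; is-instance = is-instance (robots j)
      ; width       = width (robots j)
      ; in-tree     = in-tree (robots j)
      ; account     = account (robots j)
      ; owned       = λ { (here refl) eq → contradiction (sym eq) j≢i ; (there e∈) eq → owned (robots j) e∈ eq }
      }
    boards′ : ∀ u → BoardInv R′ V′ u
      (updNode (board c) p (whiteboard (v ∷ taken b) (knowledge m ∪ posted b)) u)
    boards′ u with ≡-dec ℕ._≟_ u p
    ... | yes refl = record
      { posted-sound   = lift (Sound-∪ (sound (robots i)) (posted-sound (boards p)))
      -- The new mark is justified by the left half of the posted union, which is exactly what `e₀`
      -- saw.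
      ; taken-sound    = λ { (here refl) → e₀ , here refl , refl , ∈-++⁺ˡ
                           ; (there w∈) → TakenWithin-mono there (∈-++⁺ʳ (mined (knowledge m))) (taken-sound (boards p) w∈) }
      ; taken-complete = λ { (here refl) _ → here refl ; (there e∈) eq → there (taken-complete (boards p) e∈ eq) }
      }
    ... | no u≢p = record
      { posted-sound   = lift (posted-sound (boards u))
      ; taken-sound    = TakenWithin-mono there (λ w∈ → w∈) ∘ taken-sound (boards u)
      ; taken-complete = λ { (here refl) eq → contradiction (sym (∷ʳ-injectiveˡ p u (trans (sym (proj₂ v-child)) eq))) u≢p
                           ; (there e∈) eq → taken-complete (boards u) e∈ eq }
      }

  -- Mining a node and moving towards the target.

  -- An empty frontier is no valid layer, so nothing is claimed about the move then; but every tree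
  -- node is then mined and thus visited. `V′` already counts `p`, visited by the present
  -- activation.
  mineAndMove-preserves : ∀ {V V′ s c i} → Inv V s c → (∀ {u} → V u → V′ u) → V′ (pos c i) →
    let p = pos c i ; b = board c p ; kids = children p (neighbours tree p) in
    untaken b kids ≡ [] → let o = mineAndMove p (mem c i) b kids in
    (Inv V′ (suc s) (apply c i o) × proj₂ (proj₂ o) ∈ neighbours tree p) ⊎ (∀ u → u ∈ tree → V′ u)
  mineAndMove-preserves {V} {V′} {s} {c} {i} I V⊆ Vp all-taken = go (frontier K′) refl
    where
    open Inv I
    p : Node
    p = pos c i
    m : Memory
    m = mem c i
    b : Whiteboard
    b = board c p
    kids : List Node
    kids = children p (neighbours tree p)
    K K′ : Knowledge
    K = knowledge m ∪ posted b
    K′ = mine p kids K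
    t q : Node
    t = ℓ (layers m ∷ʳ frontier K′)
    q = toward p t
    lift : ∀ {K} → Sound R V K → Sound R V′ K
    lift = Sound-mono (λ e∈ → e∈) V⊆
    child-taken : ∀ {a} → (p ∷ʳ a) ∈ tree → (p ∷ʳ a) ∈ taken b
    child-taken {a} v∈ with (p ∷ʳ a) ∈? taken b
    ... | yes v∈taken = v∈taken
    ... | no v∉taken = contradiction
      (subst ((p ∷ʳ a) ∈_) all-taken (∈-filter⁺ (λ v → ¬? (v ∈? taken b)) (children⁺ v∈) v∉taken)) λ ()
    K′-sound : Sound R V′ K′
    K′-sound = Sound-mine Vp
      (λ v∈ → TakenWithin-mono (λ e∈ → e∈) (∈-++⁺ʳ (mined (knowledge m))) (taken-sound (boards p) (child-taken v∈)))
      (lift (Sound-∪ (sound (robots i)) (posted-sound (boards p))))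
    M⊆ : ∀ {u} → u ∈ mined (knowledge m) → u ∈ mined K′
    M⊆ u∈ = there (∈-++⁺ˡ u∈)

    module Live (nonempty : NonEmpty (frontier K′)) where
      instance′ : IsInstance (layers m ∷ʳ frontier K′)
      instance′ with layers m | last-layer (robots i) | is-instance (robots i)
      ... | _ | ls , refl | all , linked = ∷ʳ⁺ all (frontier-isLayer K′ , nonempty) ,
        Linked-∷ʳ ls linked (frontier-⪰ (sound (robots i)) K′-sound M⊆)
      t∈frontier : t ∈ frontier K′
      t∈frontier = traversal (layers m) (frontier K′) instance′
      t∈tree : t ∈ tree
      t∈tree = known⊆tree K′-sound (proj₁ (frontier⁻ K′ t∈frontier))
      p≢t : p ≢ t
      p≢t p≡t = proj₁ (proj₂ (frontier⁻ K′ t∈frontier)) (here (sym p≡t))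
      p∈tree : p ∈ tree
      p∈tree = pos∈tree (robots i)
      q∈neighbours : q ∈ neighbours tree p
      q∈neighbours with toward-adjacent p t p≢t
      ... | inj₁ (a , q≡ , ≼t) = subst (_∈ neighbours tree p) (sym q≡)
        (proj₁ (children⁻ {p} (children⁺ {p} {a} (tree-prefix ≼t t∈tree))))
      ... | inj₂ (a , p≡) = parent∈neighbours p∈tree p≡
      q∈tree : q ∈ tree
      q∈tree = proj₁ (∈-filter⁻ _ {xs = tree} q∈neighbours)
      -- A step leaves the subtree of an ancestor of `p` only by going up from `p` itself, which has
      -- just been mined.
      leaves : ∀ {v} → v ≼ p → v ≼ q ⊎ v ∈ mined K′
      leaves v≼p with toward-adjacent p t p≢t
      ... | inj₁ (a , q≡ , _) = inj₁ (subst (_ ≼_) (sym q≡) (≼-trans v≼p (≼-∷ʳ a)))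
      ... | inj₂ (a , p≡) with ≼-∷ʳ⁻ (subst (_ ≼_) p≡ v≼p)
      ...   | inj₁ v≡ = inj₂ (here (trans v≡ (sym p≡)))
      ...   | inj₂ v≼q = inj₁ v≼q
      cost≡ : cost ℓ (layers m ∷ʳ frontier K′) ≡ cost ℓ (layers m) + dist (ℓ (layers m)) t
      cost≡ with layers m | last-layer (robots i)
      ... | _ | ls , refl = cost-∷ʳ ℓ ls _ _
      -- The move is paid by the approach to the new target `t`; the change of target raises the
      -- potential by at most `dist t₀ t`, which is also added to the cost.
      accounting : suc (moves i) + dist q t ≤ 2 * fresh i + cost ℓ (layers m ∷ʳ frontier K′)
      accounting = begin
        suc (moves i) + dist q t                ≡⟨ +-suc (moves i) (dist q t) ⟨
        moves i + suc (dist q t)                ≤⟨ +-monoʳ-≤ (moves i) (toward-closer p t p≢t) ⟩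
        moves i + dist p t                      ≤⟨ +-monoʳ-≤ (moves i) (dist-triangle p t₀ t) ⟩
        moves i + (dist p t₀ + dist t₀ t)       ≡⟨ +-assoc (moves i) _ _ ⟨
        moves i + dist p t₀ + dist t₀ t         ≤⟨ +-monoˡ-≤ (dist t₀ t) (account (robots i)) ⟩
        2 * fresh i + cost ℓ (layers m) + dist t₀ t    ≡⟨ +-assoc (2 * fresh i) _ _ ⟩
        2 * fresh i + (cost ℓ (layers m) + dist t₀ t)  ≡⟨ cong (2 * fresh i +_) cost≡ ⟨
        2 * fresh i + cost ℓ (layers m ∷ʳ frontier K′) ∎
        where
        open ≤-Reasoning
        t₀ : Node
        t₀ = ℓ (layers m)
      robots′ : ∀ j → RobotInv R V′ j (updFin (pos c) i q j)
        (updFin (mem c) i (memory q K′ (layers m ∷ʳ frontier K′)) j)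
        (updFin moves i (suc (moves i)) j) (fresh j)
      robots′ j with j Fin.≟ i
      ... | yes refl = record
        { position≡   = refl
        ; pos∈tree    = q∈tree
        ; sound       = K′-sound
        ; last-layer  = layers m , refl
        ; is-instance = instance′
        ; width       = ∷ʳ⁺ (width (robots i)) (frontier-width ledger K′-sound)
        ; in-tree     = ∷ʳ⁺ (in-tree (robots i))
            (All.tabulate λ v∈ → known⊆tree K′-sound (proj₁ (frontier⁻ K′ v∈)))
        ; account     = accounting
        ; owned       = λ e∈ eq → [ leaves , inj₂ ∘ M⊆ ]′ (owned (robots i) e∈ eq)
        }
      ... | no j≢i = record
        { position≡   = position≡ (robots j)
        ; pos∈tree    = pos∈tree (robots j)
        ; sound       = lift (sound (robots j))
        ; last-layer  = last-layer (robots j)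
        ; is-instance = is-instance (robots j)
        ; width       = width (robots j)
        ; in-tree     = in-tree (robots j)
        ; account     = account (robots j)
        ; owned       = owned (robots j)
        }
      boards′ : ∀ u → BoardInv R V′ u (updNode (board c) p (whiteboard (taken b) K′) u)
      boards′ u with ≡-dec ℕ._≟_ u p
      ... | yes refl = record
        { posted-sound   = K′-sound
        ; taken-sound    = TakenWithin-mono (λ e∈ → e∈) (there ∘ ∈-++⁺ʳ (mined (knowledge m))) ∘ taken-sound (boards p)
        ; taken-complete = taken-complete (boards p)
        }
      ... | no u≢p = record
        { posted-sound   = lift (posted-sound (boards u))
        ; taken-sound    = taken-sound (boards u)
        ; taken-complete = taken-complete (boards u)
        }
      inv : Inv V′ (suc s) (apply c i (mineAndMove p m b kids))
      inv = record
        { ledger    = ledger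
        ; moves     = updFin moves i (suc (moves i))
        ; fresh     = fresh
        ; moves-sum = trans (sum-updFin moves i) (cong suc moves-sum)
        ; fresh-sum = fresh-sum
        ; robots    = robots′
        ; boards    = boards′
        }

    go : ∀ F → frontier K′ ≡ F →
      (Inv V′ (suc s) (apply c i (mineAndMove p m b kids)) × q ∈ neighbours tree p) ⊎ (∀ u → u ∈ tree → V′ u)
    go [] empty = inj₂ (frontier-empty⇒visited K′-sound empty)
    go (v ∷ F) eq = inj₁ (inv , q∈neighbours)
      where open Live (v , subst (v ∈_) (sym eq) (here refl))

  act-preserves : ∀ {V V′ s c i} → Inv V s c → (∀ {u} → V u → V′ u) → V′ (pos c i) →
    let p = pos c i ; o = act p (mem c i) (board c p) (neighbours tree p) in
    (Inv V′ (suc s) (apply c i o) × proj₂ (proj₂ o) ∈ neighbours tree p) ⊎ (∀ u → u ∈ tree → V′ u)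
  act-preserves {c = c} {i} I V⊆ Vp
    with untaken (board c (pos c i)) (children (pos c i) (neighbours tree (pos c i))) in eq
  ... | [] = mineAndMove-preserves I V⊆ Vp eq
  ... | v ∷ vs with ∈-filter⁻ (λ v → ¬? (v ∈? taken (board c (pos c i)))) (subst (v ∈_) (sym eq) (here refl))
  ...   | v∈kids , v∉taken = inj₁ (takeEdge-preserves I V⊆ v∈kids v∉taken , proj₁ (children⁻ {pos c i} v∈kids))

  -- The initial configuration.

  initial : Fin k → ∀ {V} → Inv V 0 (initConfig explorer k)
  initial i = record
    { R         = [ entry root i [] ]
    ; ledger    = record
      { nodes-unique = [] ∷ []
      ; nodes⊆tree   = λ { (here refl) → proj₁ (proj₂ finite) }
      ; comparable   = λ { (here refl) (here refl) _ → inj₁ (inj₁ ≼-refl) }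
      ; root-taken   = entry root i [] , here refl , refl , λ ()
      }
    ; moves     = λ _ → 0
    ; fresh     = λ _ → 0
    ; moves-sum = sum-replicate-zero k
    ; fresh-sum = cong suc (sum-replicate-zero k)
    ; robots    = λ j → record
      { position≡   = refl
      ; pos∈tree    = proj₁ (proj₂ finite)
      ; sound       = Sound-initial
      ; last-layer  = [] , refl
      ; is-instance = instance₀
      ; width       = ℕ.>-nonZero⁻¹ k {{nonZeroIndex i}} ∷ []
      ; in-tree     = (proj₁ (proj₂ finite) ∷ []) ∷ []
      -- The cost also counts the leg from the root to the first target, so both sides agree.
      ; account     = ≤-reflexive (sym (+-identityʳ _))
      ; owned       = λ { (here refl) _ → inj₁ ([] , refl) }
      }
    ; boards    = λ u → record
      { posted-sound   = Sound-initial
      ; taken-sound    = λ ()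
      -- The only entry is the root, which is nobody's child.
      ; taken-complete = λ { {a = a} (here refl) eq → contradiction (cong length eq) (0≢length-∷ʳ u a) }
      }
    }
    where
    instance₀ : IsInstance [ [ root ] ]
    instance₀ = (frontier-isLayer initialKnowledge , root , here refl) ∷ [] , [-]
    0≢length-∷ʳ : ∀ (u : Node) a → 0 ≢ length (u ∷ʳ a)
    0≢length-∷ʳ [] a ()
    0≢length-∷ʳ (_ ∷ _) a ()

  -- Bounding the number of rounds.

  -- The instance may be shallower than the tree, so its bound is raised to depth `D`; this
  -- monotonicity uses the sign of `c`.
  instance-cost≤ : ∀ {c D} → Competitive ℓ c k → ℚ.0ℚ ℚ.≤ c → TreeDepth tree D → ∀ {R V j p m x y} →
    RobotInv R V j p m x y → ℕ→ℚ (cost ℓ (layers m)) ℚ.≤ c ℚ.* ℕ→ℚ D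
  instance-cost≤ {c} {D} competitive 0≤c (tree≤D , _) {m = m} I with deepest-node
    where
    deepest-node : ∃ λ v → v ∈ tree × InstanceDepth (layers m) (depth v)
    deepest-node with layers m | last-layer I | is-instance I | in-tree I
    ... | _ | ls , refl | all , _ | ⊆tree with All.lookup all (∈-++⁺ʳ ls (here refl))
    ...   | _ , u , u∈ with instanceDepth (∈-++⁺ʳ ls (here refl)) u∈
    ...     | v , v∈ , deep with ∈-concat⁻′ _ v∈
    ...       | L , v∈L , L∈ = v , All.lookup (All.lookup ⊆tree L∈) v∈L , deep
  ... | v , v∈ , deep = ℚ.≤-trans (competitive (layers m) (depth v) (is-instance I) (width I) deep)
    (ℚ.*-monoˡ-≤-nonNeg c {{ℚ.nonNegative 0≤c}} (ℕ→ℚ-mono-≤ (tree≤D v v∈)))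

  -- The bound is on `suc s` because exploration may finish in the round following a configuration
  -- that satisfies the invariant.
  rounds≤ : ∀ {c D} → Competitive ℓ c k → ℚ.0ℚ ℚ.≤ c → TreeDepth tree D → ∀ {V s conf} → Inv V s conf →
    ℕ→ℚ (suc s) ℚ.≤ ℕ→ℚ (2 * length tree) ℚ.+ ℕ→ℚ k ℚ.* c ℚ.* ℕ→ℚ D
  rounds≤ {c} {D} competitive 0≤c depth-D {s = s} {conf} I = ℚ.≤-trans (ℕ→ℚ-mono-≤ count) total
    where
    open Inv I
    costs : Fin k → ℕ
    costs j = cost ℓ (layers (mem conf j))
    per-robot : ∀ j → moves j ≤ fresh j + (fresh j + costs j)
    per-robot j = ≤-trans (m≤m+n (moves j) _) (≤-trans (account (robots j)) (≤-reflexive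
      (solve 2 (λ x y → con 2 :* x :+ y := x :+ (x :+ y)) refl (fresh j) (costs j))))
      where open +-*-Solver
    count : suc s ≤ 2 * length tree + sum costs
    count = begin
      suc s                                        ≡⟨ cong suc moves-sum ⟨
      suc (sum moves)                              ≤⟨ s≤s (sum-mono-≤ per-robot) ⟩
      suc (sum (λ j → fresh j + (fresh j + costs j)))
        ≡⟨ cong suc (trans (∑-distrib-+ fresh _) (cong (sum fresh +_) (∑-distrib-+ fresh costs))) ⟩
      -- The root's entry contributes two to the bound without any crossing: one pays for the final
      -- round, the other is slack.
      suc (sum fresh + (sum fresh + sum costs))    ≤⟨ n≤1+n _ ⟩
      2 + (sum fresh + (sum fresh + sum costs))
        ≡⟨ solve 2 (λ x y → con 2 :+ (x :+ (x :+ y)) := con 2 :* (con 1 :+ x) :+ y) refl (sum fresh) (sum costs) ⟩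
      2 * suc (sum fresh) + sum costs
        ≤⟨ +-monoˡ-≤ (sum costs) (*-monoʳ-≤ 2 (subst (_≤ length tree) (sym fresh-sum) (length-ledger ledger))) ⟩
      2 * length tree + sum costs                  ∎
      where
      open ≤-Reasoning
      open +-*-Solver
    total : ℕ→ℚ (2 * length tree + sum costs) ℚ.≤ ℕ→ℚ (2 * length tree) ℚ.+ ℕ→ℚ k ℚ.* c ℚ.* ℕ→ℚ D
    total = begin
      ℕ→ℚ (2 * length tree + sum costs)                    ≡⟨ ℕ→ℚ-homo-+ (2 * length tree) (sum costs) ⟩
      ℕ→ℚ (2 * length tree) ℚ.+ ℕ→ℚ (sum costs)
        ≤⟨ ℚ.+-monoʳ-≤ (ℕ→ℚ (2 * length tree)) (ℕ→ℚ-sum-≤ costs (c ℚ.* ℕ→ℚ D) λ j →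
             instance-cost≤ competitive 0≤c depth-D (robots j)) ⟩
      ℕ→ℚ (2 * length tree) ℚ.+ ℕ→ℚ k ℚ.* (c ℚ.* ℕ→ℚ D)
        ≡⟨ cong (ℕ→ℚ (2 * length tree) ℚ.+_) (ℚ.*-assoc (ℕ→ℚ k) c (ℕ→ℚ D)) ⟨
      ℕ→ℚ (2 * length tree) ℚ.+ ℕ→ℚ k ℚ.* c ℚ.* ℕ→ℚ D      ∎
      where open ℚ.≤-Reasoning

  -- Runs under a schedule.

  module Run (σ : ℕ → Fin k) where

    conf : ℕ → Config explorer k
    conf = run explorer k tree σ

    Visited : ℕ → Node → Set
    Visited t u = ∃ λ s → s < t × pos (conf s) (σ s) ≡ u

    Visited-mono : ∀ {t t′ u} → t ≤ t′ → Visited t u → Visited t′ u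
    Visited-mono t≤ (s , s< , eq) = s , <-≤-trans s< t≤ , eq

    RunInv : ℕ → Set
    RunInv s = Inv (Visited s) s (conf s)

    advance : ∀ s → RunInv s →
      (RunInv (suc s) × ValidMove explorer k tree σ s) ⊎ AllVisited explorer k tree σ (suc s)
    -- The program acts at the remembered position and `act-preserves` speaks of the actual one;
    -- `position≡` identifies them.
    advance s I = subst
      (λ x → let o = act x (mem (conf s) (σ s)) (board (conf s) (pos (conf s) (σ s))) (neighbours tree (pos (conf s) (σ s)))
             in (Inv (Visited (suc s)) (suc s) (apply (conf s) (σ s) o) × proj₂ (proj₂ o) ∈ neighbours tree (pos (conf s) (σ s)))
                ⊎ AllVisited explorer k tree σ (suc s))
      (sym (position≡ (Inv.robots I (σ s))))
      (act-preserves I (Visited-mono (n≤1+n s)) (s , ≤-refl , refl))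

    -- The invariant need not survive the activation that finds the frontier empty, so a finished
    -- run keeps the last round `t` at which it held.
    progress : ∀ n → RunInv n ⊎ ∃ λ t → t < n × RunInv t × AllVisited explorer k tree σ (suc t)
    progress zero = inj₁ (initial (σ 0))
    progress (suc n) with progress n
    ... | inj₂ (t , t<n , done) = inj₂ (t , m<n⇒m<1+n t<n , done)
    ... | inj₁ I with advance n I
    ...   | inj₁ (I′ , _) = inj₁ I′
    ...   | inj₂ all-visited = inj₂ (n , ≤-refl , I , all-visited)

    moves-valid : ∀ s → ¬ AllVisited explorer k tree σ (suc s) → ValidMove explorer k tree σ s
    moves-valid s unfinished with progress s
    ... | inj₂ (t , t<s , _ , done) = contradiction (λ u u∈ → Visited-mono (m≤n⇒m≤1+n t<s) (done u u∈)) unfinished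
    ... | inj₁ I with advance s I
    ...   | inj₁ (_ , valid) = valid
    ...   | inj₂ done = contradiction done unfinished

    -- Take a natural number `n` above `B`. The invariant at `n` would give `suc n` at most `B`,
    -- hence at most `n`; so exploration ended after some earlier `t`, where the invariant bounds
    -- `suc t`.
    finishes : ∀ {B} → (∀ {s} → RunInv s → ℕ→ℚ (suc s) ℚ.≤ B) →
      ∃ λ t → ℕ→ℚ t ℚ.≤ B × AllVisited explorer k tree σ t
    finishes {B} bound with archimedean B
    ... | n , B≤n with progress n
    ...   | inj₁ I = contradiction (ℕ→ℚ-cancel-≤ {suc n} {n} (ℚ.≤-trans (bound I) B≤n)) 1+n≰n
    ...   | inj₂ (t , _ , I , done) = suc t , bound I , done

-- On a single layer at depth one, the bound is `c` itself and dominates a cost, which is a natural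
-- number.
competitive⇒nonneg : ∀ {k ℓ c} → 1 ≤ k → Competitive ℓ c k → ℚ.0ℚ ℚ.≤ c
competitive⇒nonneg {ℓ = ℓ} {c} 1≤k competitive = begin
  ℚ.0ℚ                 ≤⟨ ℕ→ℚ-mono-≤ {n = cost ℓ ls} z≤n ⟩
  ℕ→ℚ (cost ℓ ls)      ≤⟨ competitive ls 1 is-instance (1≤k ∷ []) depth-1 ⟩
  c ℚ.* ℚ.1ℚ           ≡⟨ ℚ.*-identityʳ c ⟩
  c                    ∎
  where
  open ℚ.≤-Reasoning
  ls : List Layer
  ls = [ [ [ 0 ] ] ]
  is-instance : IsInstance ls
  is-instance = (([] ∷ [] , λ { (here refl) (here refl) _ → refl }) , [ 0 ] , here refl) ∷ [] , [-]
  depth-1 : InstanceDepth ls 1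
  depth-1 = (λ { u (_ , here refl , _ , here refl , u≼) → ≼-depth u≼ }) ,
    [ 0 ] , ([ [ 0 ] ] , here refl , [ 0 ] , here refl , ≼-refl) , refl

theorem5 : (k : ℕ) (ℓ : TraversalFn) (c : ℚ) →
    IsTraversal ℓ → IsLazy ℓ → Competitive ℓ c k →
    Σ DACTE λ A → (T : List Node) → IsFiniteTree T → (D : ℕ) → TreeDepth T D →
    (σ : ℕ → Fin k) →
    ExploresWithin A k T σ (ℕ→ℚ (2 * length T) ℚ.+ ℕ→ℚ k ℚ.* c ℚ.* ℕ→ℚ D)
theorem5 k ℓ c traversal _ competitive = Exploration.explorer ℓ , λ T finite D depth-D σ →
  let open Correctness ℓ traversal finite
      open Run σ
      -- A schedule names a robot at round zero, so there is at least one.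
      0≤c = competitive⇒nonneg (ℕ.>-nonZero⁻¹ k {{nonZeroIndex (σ 0)}}) competitive
  in moves-valid , finishes (rounds≤ competitive 0≤c depth-D)
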